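{- For any graph $G$ on $n$ vertices, there is an embedding $\phi\colon \mathcal{F}(G) \to \mathbb{Q}^{2^n-1}$ such that $\phi$ keeps convex structure (i.e. $\phi(\lambda \mathbf{c}_1 + (1-\lambda)\mathbf{c}_2)=\lambda\phi(\mathbf{c}_1)+(1-\lambda)\phi(\mathbf{c}_2)$ for all rational $\lambda\in[0,1]$). Moreover, for any rational number $\tau$, $\mathcal{F}_\tau(G)$ is the convex hull of some extremal fractional colorings.
   Context: Let $G$ be a graph. A $b$-fold coloring $\mathbf{c}$ of $G$ assigns a set of $b$ colors to each vertex so that adjacent vertices receive disjoint sets; $A(\mathbf{c})=\cup_{v\in V(G)}\mathbf{c}(v)$ is the set of colors used. Two $b$-fold colorings are isomorphic if they differ by a bijection of color sets; $\mathcal{C}_b(G)$ is the set of isomorphism classes of $b$-fold colorings and $\mathcal{C}(G)=\cup_{b\ge 0}\mathcal{C}_b(G)$. For $\mathbf{c}_1\in\mathcal{C}_{b_1}(G)$, $\mathbf{c}_2\in\mathcal{C}_{b_2}(G)$, the sum $\mathbf{c}_1+\mathbf{c}_2\in\mathcal{C}_{b_1+b_2}(G)$ assigns to each $v$ the disjoint union $\mathbf{c}_1(v)\sqcup\mathbf{c}_2(v)$, and $t\cdot\mathbf{c}$ is the sum of $t$ copies of $\mathbf{c}$. We write $\mathbf{c}_1\sim\mathbf{c}_2$ if $sb_2\cdot\mathbf{c}_1\cong sb_1\cdot\mathbf{c}_2$ for some positive integer $s$; this is an equivalence relation. The set of fractional colorings is $\mathcal{F}(G)=\mathcal{C}(G)/\sim$,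 and the class of $\mathbf{c}\in\mathcal{C}_b(G)$ is denoted $\frac{\mathbf{c}}{b}$. For rational $\lambda=\frac{q}{p}\in[0,1]$, the convex combination is $\lambda\frac{\mathbf{c}_1}{b_1}+(1-\lambda)\frac{\mathbf{c}_2}{b_2}=\frac{qb_2\cdot\mathbf{c}_1+(p-q)b_1\cdot\mathbf{c}_2}{pb_1b_2}$ (well defined). Define $g_G(\frac{\mathbf{c}}{b})=\frac{|A(\mathbf{c})|}{b}$ and, for $\tau>0$, $\mathcal{F}_\tau(G)=\{\frac{\mathbf{c}}{b}\in\mathcal{F}(G): g_G(\frac{\mathbf{c}}{b})\le\tau\}$. A fractional coloring is extremal in $\mathcal{F}_\tau(G)$ if it cannot be written as a linear (convex) combination of two or more distinct fractional colorings in $\mathcal{F}_\tau(G)$. -}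

module Defs where

open import Data.Nat using (ℕ; zero; suc; _+_; _*_; _∸_; _≤_; _<_; NonZero)
open import Data.Nat.Properties using (m*n≢0)
open import Data.Bool using (Bool; true; false)
open import Data.Fin using (Fin; zero; suc; splitAt; _↑ˡ_; _↑ʳ_; join)
open import Data.Fin.Properties using (join-splitAt)
open import Data.Fin.Subset using (Subset; _∈_; ∣_∣; inside; outside)
open import Data.Vec using (Vec; []; _∷_; _++_; here; there)
open import Data.Sum using (_⊎_; inj₁; inj₂)
open import Data.Product using (Σ; ∃; _×_; _,_; proj₁; proj₂)
open import Data.Empty using (⊥)
open import Data.Integer using (+_)
open import Data.Rational using (ℚ; _/_) renaming (_≤_ to _≤ℚ_)
open import Relation.Nullary using (¬_)
open import Function.Bundles using (_↔_; _⇔_; Inverse)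
open import Relation.Binary.PropositionalEquality
  using (_≡_; refl; trans; cong; subst)

record Graph (n : ℕ) : Set where
  field
    Adj     : Fin n → Fin n → Bool
    adj-sym : ∀ u v → Adj u v ≡ Adj v u
    loopless : ∀ v → Adj v v ≡ false
open Graph public

-- b-fold colourings.  An isomorphism class of b-fold colourings is
-- represented by a colouring whose colour set is Fin m and in which
-- every colour is used, i.e. A(c) = Fin m (every class has such a
-- representative: rename the used colours as 0 … |A(c)|-1).

record Coloring {n : ℕ} (G : Graph n) (b : ℕ) : Set where
  field
    m      : ℕ
    col    : Fin n → Subset m
    size   : ∀ v → ∣ col v ∣ ≡ b
    proper : ∀ u v → Adj G u v ≡ true →
             ∀ x → x ∈ col u → x ∈ col v → ⊥
    used   : ∀ x → ∃ λ v → x ∈ col v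
open Coloring public

_≅_ : ∀ {n} {G : Graph n} {b₁ b₂} → Coloring G b₁ → Coloring G b₂ → Set
_≅_ {n} c₁ c₂ =
  Σ (Fin (m c₁) ↔ Fin (m c₂)) λ σ →
    ∀ (v : Fin n) (x : Fin (m c₁)) → (x ∈ col c₁ v) ⇔ (Inverse.to σ x ∈ col c₂ v)

private
  count-++ : ∀ {k l} (p : Subset k) (q : Subset l) → ∣ p ++ q ∣ ≡ ∣ p ∣ + ∣ q ∣
  count-++ []            q = refl
  count-++ (true  ∷ p) q = cong suc (count-++ p q)
  count-++ (false ∷ p) q = count-++ p q

  SplitMem : ∀ {k l} → Subset k → Subset l → Fin k ⊎ Fin l → Set
  SplitMem p q (inj₁ y) = y ∈ p
  SplitMem p q (inj₂ z) = z ∈ q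

  ∈-++⁻ : ∀ {k l} (p : Subset k) (q : Subset l) (x : Fin (k + l)) →
          x ∈ p ++ q → SplitMem p q (splitAt k x)
  ∈-++⁻ []      q x       h         = h
  ∈-++⁻ (s ∷ p) q zero    here      = here
  ∈-++⁻ {suc k} (s ∷ p) q (suc x) (there h) with splitAt k x | ∈-++⁻ p q x h
  ... | inj₁ y | r = there r
  ... | inj₂ z | r = r

  ∈-++ˡ : ∀ {k l} (p : Subset k) (q : Subset l) (y : Fin k) → y ∈ p → (y ↑ˡ l) ∈ p ++ q
  ∈-++ˡ (s ∷ p) q zero    here      = here
  ∈-++ˡ (s ∷ p) q (suc y) (there h) = there (∈-++ˡ p q y h)

  ∈-++ʳ : ∀ {k l} (p : Subset k) (q : Subset l) (z : Fin l) → z ∈ q → (k ↑ʳ z) ∈ p ++ q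
  ∈-++ʳ []      q z h = h
  ∈-++ʳ (s ∷ p) q z h = there (∈-++ʳ p q z h)

_⊕_ : ∀ {n} {G : Graph n} {b₁ b₂} → Coloring G b₁ → Coloring G b₂ → Coloring G (b₁ + b₂)
_⊕_ {n} {G} {b₁} {b₂} c₁ c₂ = record
  { m      = m c₁ + m c₂
  ; col    = λ v → col c₁ v ++ col c₂ v
  ; size   = λ v → trans (count-++ (col c₁ v) (col c₂ v))
                         (cong₂' (size c₁ v) (size c₂ v))
  ; proper = prop
  ; used   = usd
  }
  where
  cong₂' : ∀ {a a' c c'} → a ≡ a' → c ≡ c' → a + c ≡ a' + c'
  cong₂' refl refl = refl

  prop : ∀ u v → Adj G u v ≡ true → ∀ x →
         x ∈ col c₁ u ++ col c₂ u → x ∈ col c₁ v ++ col c₂ v → ⊥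
  prop u v e x hu hv with splitAt (m c₁) x
                        | ∈-++⁻ (col c₁ u) (col c₂ u) x hu
                        | ∈-++⁻ (col c₁ v) (col c₂ v) x hv
  ... | inj₁ y | ru | rv = proper c₁ u v e y ru rv
  ... | inj₂ z | ru | rv = proper c₂ u v e z ru rv

  usd : ∀ x → ∃ λ v → x ∈ col c₁ v ++ col c₂ v
  usd x with splitAt (m c₁) x | join-splitAt (m c₁) (m c₂) x
  ... | inj₁ y | eq with used c₁ y
  ...   | v , h = v , subst (λ w → w ∈ col c₁ v ++ col c₂ v) eq
                             (∈-++ˡ (col c₁ v) (col c₂ v) y h)
  usd x | inj₂ z | eq with used c₂ z
  ...   | v , h = v , subst (λ w → w ∈ col c₁ v ++ col c₂ v) eq
                             (∈-++ʳ (col c₁ v) (col c₂ v) z h)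

empty : ∀ {n} {G : Graph n} → Coloring G 0
empty = record
  { m = 0 ; col = λ _ → [] ; size = λ _ → refl
  ; proper = λ _ _ _ () ; used = λ () }

_·_ : ∀ {n} {G : Graph n} {b} (t : ℕ) → Coloring G b → Coloring G (t * b)
zero  · c = empty
suc t · c = c ⊕ (t · c)

-- Fractional colourings: pairs (b , c) with b ≥ 1 and c a b-fold
-- colouring; the class c/b is taken modulo the relation _∼_ below.

record Frac {n : ℕ} (G : Graph n) : Set where
  constructor frac
  field
    b       : ℕ
    {{nz}}  : NonZero b
    c       : Coloring G b
open Frac public

_∼_ : ∀ {n} {G : Graph n} → Frac G → Frac G → Set
x ∼ y = Σ ℕ λ s → NonZero s × ((s * b y) · c x) ≅ ((s * b x) · c y)

private
  nz+ : ∀ a d → NonZero a → NonZero (a + d)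
  nz+ (suc a) d _ = _

  nz-comb : ∀ q p b₁ b₂ → q ≤ p → .{{NonZero p}} → .{{NonZero b₁}} → .{{NonZero b₂}} →
            NonZero (q * b₂ * b₁ + (p ∸ q) * b₁ * b₂)
  nz-comb zero    p b₁ b₂ _ = m*n≢0 (p * b₁) b₂ {{m*n≢0 p b₁}}
  nz-comb (suc q) p b₁ b₂ _ =
    nz+ (suc q * b₂ * b₁) ((p ∸ suc q) * b₁ * b₂)
        (m*n≢0 (suc q * b₂) b₁ {{m*n≢0 (suc q) b₂}})

-- Convex combination  (q/p) (c₁/b₁) + (1 - q/p) (c₂/b₂)
--   = (q b₂ · c₁ + (p - q) b₁ · c₂) / (p b₁ b₂),   for 0 ≤ q ≤ p, p ≥ 1.
-- (The number of colours per vertex, q b₂ b₁ + (p - q) b₁ b₂, equals p b₁ b₂.)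
comb : ∀ {n} {G : Graph n} (q p : ℕ) → q ≤ p → .{{NonZero p}} → Frac G → Frac G → Frac G
comb q p q≤p {{p≢0}} x y =
  record { b  = q * b y * b x + (p ∸ q) * b x * b y
         ; nz = nz-comb q p (b x) (b y) q≤p {{p≢0}} {{nz x}} {{nz y}}
         ; c  = ((q * b y) · c x) ⊕ (((p ∸ q) * b x) · c y) }

g : ∀ {n} {G : Graph n} → Frac G → ℚ
g x = (+ m (c x)) / b x

Fτ : ∀ {n} {G : Graph n} → ℚ → Frac G → Set
Fτ τ x = g x ≤ℚ τ

Extremal : ∀ {n} {G : Graph n} → ℚ → Frac G → Set
Extremal {G = G} τ x =
  Fτ τ x ×
  ¬ (Σ (Frac G) λ y → Σ (Frac G) λ z →
     Σ ℕ λ q → Σ ℕ λ p → Σ (NonZero p) λ p≢0 → Σ (q ≤ p) λ q≤p →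
       0 < q × q < p × Fτ τ y × Fτ τ z × ¬ (y ∼ z) ×
       (x ∼ comb q p q≤p {{p≢0}} y z))

data Hull {n} {G : Graph n} (S : Frac G → Set) : Frac G → Set where
  member : ∀ {x} → S x → Hull S x
  resp   : ∀ {x y} → x ∼ y → Hull S x → Hull S y
  mix    : ∀ {x y} (q p : ℕ) (q≤p : q ≤ p) .{{_ : NonZero p}} →
           Hull S x → Hull S y → Hull S (comb q p q≤p x y)

{-# OPTIONS --safe #-}
module Submission where

-- The embedding records, for every nonempty vertex set T, the number of colours whose
-- class is exactly T, divided by b.  These numbers determine a colouring up to
-- isomorphism, and every weighting of independent sets with the same total b over each
-- vertex arises from a colouring.  Hence F_τ consists of the rational points of the
-- polytope w ≥ 0, Σ_{T ∋ v} w_T = 1, slack + Σ_T w_T = τ.  If the equations admit a nonzero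
-- direction supported on the support of a point, that direction has entries of both signs,
-- and moving along it both ways until a coordinate vanishes writes the point as a
-- convex combination of two points with smaller support; otherwise the point is extremal.

open import Defs

module FractionalColorings where

  open import Data.Nat as ℕ using (ℕ; zero; suc; _^_; _∸_; NonZero)
  import Data.Nat.Properties as ℕ
  open import Data.Nat.Induction using (Acc; acc)
  open import Data.Integer hiding (suc; _^_; NonZero)
  open import Data.Integer.Properties
  open import Data.Integer.Tactic.RingSolver using (solve-∀)
  open import Data.Rational as ℚ using (ℚ; ↥_; ↧_; mkℚ; toℚᵘ)
  import Data.Rational.Properties as ℚ
  open import Data.Rational.Unnormalised as ℚᵘ using (mkℚᵘ; *≤*; *≡*)
  import Data.Rational.Unnormalised.Properties as ℚᵘ
  open import Data.Fin as Fin using (Fin; zero; suc; splitAt; combine; remQuot; punchIn; punchOut)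
  open import Data.Fin.Permutation as Perm using (Permutation; _⟨$⟩ʳ_)
  open import Data.Fin.Properties
    using (any?; remQuot-combine; combine-remQuot; 2↔Bool; punchIn-punchOut)
  open import Data.Fin.Subset as Subset using (Subset; _∈_)
  open import Data.Vec using ([]; _∷_; lookup; tabulate)
  open import Data.Vec.Functional using () renaming (_∷_ to _∷ᶠ_)
  open import Data.Vec.Properties
    using (lookup∘tabulate; tabulate∘lookup; tabulate-cong; []=⇒lookup; lookup⇒[]=; lookup-splitAt; lookup-replicate)
  open import Data.Bool using (Bool; true; false; if_then_else_)
  open import Data.Product using (∃; _×_; _,_; proj₁; proj₂)
  open import Data.Sum using (_⊎_; inj₁; inj₂; [_,_]′; map₁)
  open import Data.Empty using (⊥)
  open import Relation.Nullary using (Dec; does; yes; no; contradiction)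
  open import Relation.Nullary.Decidable using (¬?; dec-true; dec-false)
  open import Function using (_∘_; const; _⇔_; mk⇔; Inverse; Equivalence)
  open import Relation.Binary.PropositionalEquality hiding (resp; [_])
  open import Algebra.Properties.AbelianGroup +-0-abelianGroup using () renaming (∙-cancelˡ to +-cancelˡ)
  open import Algebra.Properties.Semiring.Sum +-*-semiring
    using (sum; sum-cong-≗; sum-remove; ∑-comm; *-distribˡ-sum; sum-permute)

  -- Integer linear algebra

  0≤*0≤ : ∀ {i j} → 0ℤ ≤ i → 0ℤ ≤ j → 0ℤ ≤ i * j
  0≤*0≤ {i} {j} 0≤i 0≤j =
    subst (_≤ i * j) (*-zeroʳ i) (*-monoˡ-≤-nonNeg i {{nonNegative 0≤i}} 0≤j)

  0<*0< : ∀ {i j} → 0ℤ < i → 0ℤ < j → 0ℤ < i * j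
  0<*0< {i} {j} 0<i 0<j =
    subst (_< i * j) (*-zeroʳ i) (*-monoˡ-<-pos i {{positive 0<i}} 0<j)

  0<*⇒0≤ : ∀ {i j} → 0ℤ < i → 0ℤ ≤ i * j → 0ℤ ≤ j
  0<*⇒0≤ {i} {j} 0<i 0≤ij =
    *-cancelˡ-≤-pos 0ℤ j i {{positive 0<i}} (subst (_≤ i * j) (sym (*-zeroʳ i)) 0≤ij)

  *≡0⇒≡0 : ∀ {i j} → i ≢ 0ℤ → i * j ≡ 0ℤ → j ≡ 0ℤ
  *≡0⇒≡0 {i} i≢0 ij≡0 with i*j≡0⇒i≡0∨j≡0 i ij≡0
  ... | inj₁ i≡0 = contradiction i≡0 i≢0
  ... | inj₂ j≡0 = j≡0

  0≤⇒0≤+ : ∀ {i j} → 0ℤ ≤ i → 0ℤ ≤ j → 0ℤ ≤ i + j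
  0≤⇒0≤+ = +-mono-≤

  +≡0⇒≡0 : ∀ {i j} → 0ℤ ≤ i → 0ℤ ≤ j → i + j ≡ 0ℤ → i ≡ 0ℤ × j ≡ 0ℤ
  +≡0⇒≡0 {i} {j} 0≤i 0≤j i+j≡0 =
    ≤-antisym (subst (i ≤_) i+j≡0 (subst (_≤ i + j) (+-identityʳ i) (+-monoʳ-≤ i 0≤j))) 0≤i ,
    ≤-antisym (subst (j ≤_) i+j≡0 (subst (_≤ i + j) (+-identityˡ j) (+-monoˡ-≤ j 0≤i))) 0≤j

  <0⇒0<- : ∀ {i} → i < 0ℤ → 0ℤ < - i
  <0⇒0<- = neg-mono-<

  sum-linear : ∀ {k} a c (u v : Fin k → ℤ) →
               sum (λ i → a * u i + c * v i) ≡ a * sum u + c * sum v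
  sum-linear {zero}  a c u v = sym (cong₂ _+_ (*-zeroʳ a) (*-zeroʳ c))
  sum-linear {suc k} a c u v =
    trans (cong (λ s → (a * u zero + c * v zero) + s) (sum-linear a c (u ∘ suc) (v ∘ suc)))
          (regroup a c (u zero) (v zero) _ _)
    where
    regroup : ∀ a c u v s t → (a * u + c * v) + (a * s + c * t) ≡ a * (u + s) + c * (v + t)
    regroup = solve-∀

  sum-zero : ∀ {k} (u : Fin k → ℤ) → (∀ i → u i ≡ 0ℤ) → sum u ≡ 0ℤ
  sum-zero {zero}  u u≡0 = refl
  sum-zero {suc k} u u≡0 = cong₂ _+_ (u≡0 zero) (sum-zero (u ∘ suc) (u≡0 ∘ suc))

  sum-nonneg : ∀ {k} (u : Fin k → ℤ) → (∀ i → 0ℤ ≤ u i) → 0ℤ ≤ sum u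
  sum-nonneg {zero}  u 0≤u = ≤-refl
  sum-nonneg {suc k} u 0≤u = 0≤⇒0≤+ (0≤u zero) (sum-nonneg (u ∘ suc) (0≤u ∘ suc))

  sum-nonneg-≡0 : ∀ {k} (u : Fin k → ℤ) → (∀ i → 0ℤ ≤ u i) → sum u ≡ 0ℤ → ∀ i → u i ≡ 0ℤ
  sum-nonneg-≡0 {suc k} u 0≤u ∑u≡0 i
    with +≡0⇒≡0 (0≤u zero) (sum-nonneg (u ∘ suc) (0≤u ∘ suc)) ∑u≡0 | i
  ... | u₀≡0 , _ | zero  = u₀≡0
  ... | _ , rest | suc j = sum-nonneg-≡0 (u ∘ suc) (0≤u ∘ suc) rest j

  dot : ∀ {k} → (Fin k → ℤ) → (Fin k → ℤ) → ℤ
  dot f d = sum (λ i → f i * d i)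

  dot-linearʳ : ∀ {k} (f : Fin k → ℤ) a c x y →
                dot f (λ i → a * x i + c * y i) ≡ a * dot f x + c * dot f y
  dot-linearʳ f a c x y =
    trans (sum-cong-≗ (λ i → swap (f i) a c (x i) (y i)))
          (sum-linear a c (λ i → f i * x i) (λ i → f i * y i))
    where
    swap : ∀ f a c x y → f * (a * x + c * y) ≡ a * (f * x) + c * (f * y)
    swap = solve-∀

  dot-linearˡ : ∀ {k} a c (f h d : Fin k → ℤ) →
                dot (λ i → a * f i + c * h i) d ≡ a * dot f d + c * dot h d
  dot-linearˡ a c f h d =
    trans (sum-cong-≗ (λ i → assoc a c (f i) (h i) (d i)))
          (sum-linear a c (λ i → f i * d i) (λ i → h i * d i))
    where
    assoc : ∀ a c f h d → (a * f + c * h) * d ≡ a * (f * d) + c * (h * d)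
    assoc = solve-∀

  dot-scaleʳ : ∀ {k} (f : Fin k → ℤ) a x → dot f (λ i → a * x i) ≡ a * dot f x
  dot-scaleʳ f a x =
    trans (sum-cong-≗ (λ i → swap (f i) a (x i)))
          (trans (sum-linear a 0ℤ (λ i → f i * x i) (λ i → f i * x i)) (+-identityʳ _))
    where
    swap : ∀ f a x → f * (a * x) ≡ a * (f * x) + 0ℤ * (f * x)
    swap = solve-∀

  0<⇒+suc : ∀ {i} → 0ℤ < i → ∃ λ k → i ≡ +[1+ k ]
  0<⇒+suc {+[1+ k ]} _ = k , refl
  0<⇒+suc {+0} (+<+ ())

  Kernel : ∀ {R : Set} {k} → (R → Fin k → ℤ) → (Fin k → ℤ) → Set
  Kernel A d = ∀ r → dot (A r) d ≡ 0ℤ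

  -- Elimination asks of the row index only that a pivot can be found. Rows may thus be indexed by a
  -- disjoint union of equations and support conditions, without renumbering.
  Searchable : Set → Set₁
  Searchable R = ∀ {P : R → Set} → (∀ r → Dec (P r)) → Dec (∃ P)

  Fin-searchable : ∀ {k} → Searchable (Fin k)
  Fin-searchable = any?

  ⊎-searchable : ∀ {R S} → Searchable R → Searchable S → Searchable (R ⊎ S)
  ⊎-searchable search search′ P? with search (P? ∘ inj₁) | search′ (P? ∘ inj₂)
  ... | yes (r , h) | _           = yes (inj₁ r , h)
  ... | no  _       | yes (s , h) = yes (inj₂ s , h)
  ... | no  ¬r      | no ¬s       =
    no λ { (inj₁ r , h) → ¬r (r , h) ; (inj₂ s , h) → ¬s (s , h) }

  -- Fraction-free Gaussian elimination of the first variable by a pivot row p.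
  kernel-trivial? : ∀ {R} → Searchable R → ∀ {k} (A : R → Fin k → ℤ) →
    (∃ λ d → (∃ λ i → d i ≢ 0ℤ) × Kernel A d) ⊎ (∀ d → Kernel A d → ∀ i → d i ≡ 0ℤ)
  kernel-trivial? search {zero}  A = inj₂ λ _ _ ()
  kernel-trivial? {R} search {suc k} A with search (λ r → ¬? (A r zero ≟ 0ℤ))
  -- The first column vanishes, so the first unit vector lies in the kernel.
  ... | no no-pivot = inj₁ (1ℤ ∷ᶠ (λ _ → 0ℤ) , (zero , λ ()) , killed)
    where
    killed : Kernel A (1ℤ ∷ᶠ (λ _ → 0ℤ))
    killed r with A r zero ≟ 0ℤ
    ... | yes Ar≡0 = cong₂ _+_ (cong (_* 1ℤ) Ar≡0) (sum-zero _ (λ i → *-zeroʳ (A r (suc i))))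
    ... | no  Ar≢0 = contradiction (r , Ar≢0) no-pivot
  ... | yes (p , Ap≢0) = extend (kernel-trivial? search reduced)
    where
    reduced : R → Fin k → ℤ
    -- The pivot row itself reduces to the zero row, so it can stay in the system.
    reduced r j = A p zero * A r (suc j) + - A r zero * A p (suc j)

    extend : (∃ λ d → (∃ λ i → d i ≢ 0ℤ) × Kernel reduced d) ⊎
             (∀ d → Kernel reduced d → ∀ i → d i ≡ 0ℤ) →
             (∃ λ d → (∃ λ i → d i ≢ 0ℤ) × Kernel A d) ⊎
             (∀ d → Kernel A d → ∀ i → d i ≡ 0ℤ)
    extend (inj₁ (d , (i , di≢0) , Ad≡0)) =
      -- Back substitution without division: once the tail is scaled by the pivot, the head that
      -- solves row `p` is an integer.
      inj₁ (- dot (A p ∘ suc) d ∷ᶠ (λ j → A p zero * d j) ,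
            (suc i , λ e → di≢0 (*≡0⇒≡0 Ap≢0 e)) ,
            λ r → trans (cong (λ s → A r zero * - dot (A p ∘ suc) d + s) (dot-scaleʳ (A r ∘ suc) (A p zero) d))
                  (trans (regroup (A r zero) (dot (A p ∘ suc) d) (A p zero) (dot (A r ∘ suc) d))
                  (trans (sym (dot-linearˡ (A p zero) (- A r zero) (A r ∘ suc) (A p ∘ suc) d)) (Ad≡0 r))))
      where
      regroup : ∀ r p a s → r * - p + a * s ≡ a * s + - r * p
      regroup = solve-∀
    extend (inj₂ trivial) = inj₂ λ d Ad≡0 →
      let tail≡0 = trivial (d ∘ suc) λ r →
            trans (dot-linearˡ (A p zero) (- A r zero) (A r ∘ suc) (A p ∘ suc) (d ∘ suc))
            (trans (regroup (A p zero) (A r zero) (dot (A r ∘ suc) (d ∘ suc)) (dot (A p ∘ suc) (d ∘ suc)) (d zero))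
            (trans (cong₂ (λ u v → A p zero * u + - A r zero * v) (Ad≡0 r) (Ad≡0 p))
                   (zeros (A p zero) (A r zero))))
          head≡0 = *≡0⇒≡0 Ap≢0
            (trans (sym (trans (cong (λ s → A p zero * d zero + s)
                                  (sum-zero _ (λ j → trans (cong (A p (suc j) *_) (tail≡0 j)) (*-zeroʳ (A p (suc j))))))
                               (+-identityʳ _)))
                   (Ad≡0 p))
      in λ { zero → head≡0 ; (suc j) → tail≡0 j }
      where
      regroup : ∀ a r s t e → a * s + - r * t ≡ a * (r * e + s) + - r * (a * e + t)
      regroup = solve-∀
      zeros : ∀ a r → a * 0ℤ + - r * 0ℤ ≡ 0ℤ
      zeros = solve-∀

  -- The ratio test: i minimises x i / - d i among the negative entries of d.
  ratio-test : ∀ {k} (x d : Fin k → ℤ) → (∀ i → 0ℤ ≤ x i) → (∃ λ i → d i < 0ℤ) →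
               ∃ λ i → d i < 0ℤ × (∀ j → 0ℤ ≤ - d i * x j + x i * d j)
  ratio-test {suc k} x d 0≤x (i₀ , di₀<0) with any? (λ i → d (suc i) <? 0ℤ)
  ... | no tail≮0 = zero , head<0 i₀ di₀<0 , bound
    where
    head<0 : ∀ i → d i < 0ℤ → d zero < 0ℤ
    head<0 zero    h = h
    head<0 (suc i) h = contradiction (i , h) tail≮0
    cancel : ∀ a b → 0ℤ ≡ - a * b + b * a
    cancel = solve-∀
    bound : ∀ j → 0ℤ ≤ - d zero * x j + x zero * d j
    bound zero    = ≤-reflexive (cancel (d zero) (x zero))
    bound (suc j) = 0≤⇒0≤+ (0≤*0≤ (<⇒≤ (<0⇒0<- (head<0 i₀ di₀<0))) (0≤x (suc j)))
                           (0≤*0≤ (0≤x zero) (≮⇒≥ λ h → tail≮0 (j , h)))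
  ... | yes neg with ratio-test (x ∘ suc) (d ∘ suc) (0≤x ∘ suc) neg
  ...   | i , di<0 , bound with 0ℤ ≤? - d (suc i) * x zero + x (suc i) * d zero
  ...     | yes 0≤ = suc i , di<0 , λ { zero → 0≤ ; (suc j) → bound j }
  ...     | no  0≰ = zero , d₀<0 , bound′
    where
    d₀<0 : d zero < 0ℤ
    d₀<0 = ≰⇒> λ 0≤d₀ → 0≰ (0≤⇒0≤+ (0≤*0≤ (<⇒≤ (<0⇒0<- di<0)) (0≤x zero))
                                     (0≤*0≤ (0≤x (suc i)) 0≤d₀))
    cancel : ∀ a b → 0ℤ ≡ - a * b + b * a
    cancel = solve-∀
    -- Transitivity of the ratio comparison, cleared of denominators: the head beats `i`, and `i` is
    -- at least as good as `j`, so both terms on the left are nonnegative.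
    cross : ∀ d₀ dᵢ dⱼ x₀ xᵢ xⱼ →
              - d₀ * (- dᵢ * xⱼ + xᵢ * dⱼ) + - dⱼ * - (- dᵢ * x₀ + xᵢ * d₀) ≡
              - dᵢ * (- d₀ * xⱼ + x₀ * dⱼ)
    cross = solve-∀
    bound′ : ∀ j → 0ℤ ≤ - d zero * x j + x zero * d j
    bound′ zero    = ≤-reflexive (cancel (d zero) (x zero))
    bound′ (suc j) with 0ℤ ≤? d (suc j)
    ... | yes 0≤dj = 0≤⇒0≤+ (0≤*0≤ (<⇒≤ (<0⇒0<- d₀<0)) (0≤x (suc j))) (0≤*0≤ (0≤x zero) 0≤dj)
    ... | no  0≰dj = 0<*⇒0≤ (<0⇒0<- di<0)
      (subst (0ℤ ≤_) (cross (d zero) (d (suc i)) (d (suc j)) (x zero) (x (suc i)) (x (suc j)))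
        (0≤⇒0≤+ (0≤*0≤ (<⇒≤ (<0⇒0<- d₀<0)) (bound j))
                (0≤*0≤ (<⇒≤ (<0⇒0<- (≰⇒> 0≰dj))) (<⇒≤ (<0⇒0<- (≰⇒> 0≰))))))

  -- The size of the support, on which the final decomposition recurses.
  nonzeros : ∀ {k} → (Fin k → ℤ) → ℕ
  nonzeros {zero}  x = 0
  nonzeros {suc k} x with x zero ≟ 0ℤ
  ... | yes _ = nonzeros (x ∘ suc)
  ... | no  _ = suc (nonzeros (x ∘ suc))

  nonzeros-mono : ∀ {k} (x y : Fin k → ℤ) → (∀ j → x j ≡ 0ℤ → y j ≡ 0ℤ) → nonzeros y ℕ.≤ nonzeros x
  nonzeros-mono {zero}  x y ⊆ = ℕ.z≤n
  nonzeros-mono {suc k} x y ⊆ with x zero ≟ 0ℤ | y zero ≟ 0ℤ | nonzeros-mono (x ∘ suc) (y ∘ suc) (⊆ ∘ suc)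
  ... | yes x≡0 | yes _   | ih = ih
  ... | yes x≡0 | no  y≢0 | ih = contradiction (⊆ zero x≡0) y≢0
  ... | no  _   | yes _   | ih = ℕ.m≤n⇒m≤1+n ih
  ... | no  _   | no  _   | ih = ℕ.s≤s ih

  nonzeros-strict : ∀ {k} (x y : Fin k → ℤ) → (∀ j → x j ≡ 0ℤ → y j ≡ 0ℤ) →
                    ∀ i → x i ≢ 0ℤ → y i ≡ 0ℤ → nonzeros y ℕ.< nonzeros x
  nonzeros-strict x y ⊆ zero xi≢0 yi≡0
    with x zero ≟ 0ℤ | y zero ≟ 0ℤ | nonzeros-mono (x ∘ suc) (y ∘ suc) (⊆ ∘ suc)
  ... | yes x≡0 | _       | _  = contradiction x≡0 xi≢0
  ... | no  _   | no  y≢0 | _  = contradiction yi≡0 y≢0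
  ... | no  _   | yes _   | ih = ℕ.s≤s ih
  nonzeros-strict x y ⊆ (suc i) xi≢0 yi≡0
    with x zero ≟ 0ℤ | y zero ≟ 0ℤ | nonzeros-strict (x ∘ suc) (y ∘ suc) (⊆ ∘ suc) i xi≢0 yi≡0
  ... | yes x≡0 | yes _   | ih = ih
  ... | yes x≡0 | no  y≢0 | ih = contradiction (⊆ zero x≡0) y≢0
  ... | no  _   | yes _   | ih = ℕ.m≤n⇒m≤1+n ih
  ... | no  _   | no  _   | ih = ℕ.s≤s ih

  -- Fibres of maps between finite sets

  -- Going through `does` lets `δ (suc i) (suc j)` compute to `δ i j`, on which the recursion in
  -- `dot-δ` relies.
  δ : ∀ {k} → Fin k → Fin k → ℤ
  δ i j = if does (i Fin.≟ j) then 1ℤ else 0ℤ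

  δ-refl : ∀ {k} (i : Fin k) → δ i i ≡ 1ℤ
  δ-refl i = cong (if_then 1ℤ else 0ℤ) (dec-true (i Fin.≟ i) refl)

  δ-≢ : ∀ {k} {i j : Fin k} → i ≢ j → δ i j ≡ 0ℤ
  δ-≢ {i = i} {j} i≢j = cong (if_then 1ℤ else 0ℤ) (dec-false (i Fin.≟ j) i≢j)

  δ-nonneg : ∀ {k} (i j : Fin k) → 0ℤ ≤ δ i j
  δ-nonneg i j with does (i Fin.≟ j)
  ... | true  = +≤+ ℕ.z≤n
  ... | false = ≤-refl

  dot-δ : ∀ {k} (f : Fin k → ℤ) j → dot f (δ j) ≡ f j
  dot-δ f zero =
    trans (cong₂ _+_ (*-identityʳ (f zero)) (sum-zero _ (λ i → *-zeroʳ (f (suc i)))))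
          (+-identityʳ (f zero))
  dot-δ f (suc j) =
    trans (cong₂ _+_ (*-zeroʳ (f zero)) (dot-δ (f ∘ suc) j)) (+-identityˡ (f (suc j)))

  dot-scaled-δ : ∀ {k} z j (f : Fin k → ℤ) → dot (λ i → z * δ j i) f ≡ z * f j
  dot-scaled-δ z j f = trans (sum-cong-≗ (λ i → swap z (δ j i) (f i))) (dot-δ (λ i → z * f i) j)
    where
    swap : ∀ z e f → (z * e) * f ≡ (z * f) * e
    swap = solve-∀

  sum-one : ∀ k → sum {k} (const 1ℤ) ≡ + k
  sum-one zero    = refl
  sum-one (suc k) = cong (λ s → 1ℤ + s) (sum-one k)

  sum-splitAt : ∀ a {b} (F : Fin a ⊎ Fin b → ℤ) →
                sum (F ∘ splitAt a) ≡ sum (F ∘ inj₁) + sum (F ∘ inj₂)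
  sum-splitAt zero    F = sym (+-identityˡ _)
  sum-splitAt (suc a) F =
    trans (cong (λ s → F (inj₁ zero) + s) (sum-splitAt a (F ∘ map₁ suc)))
          (sym (+-assoc (F (inj₁ zero)) _ _))

  -- The number of points over `i`, kept as an integer so that it can enter the linear algebra.
  fibre : ∀ {m k} → (Fin m → Fin k) → Fin k → ℤ
  fibre τ i = sum (λ x → δ (τ x) i)

  -- Double counting: after the two sums are exchanged, `δ` picks out one term for each point.
  dot-fibre : ∀ {m k} (f : Fin k → ℤ) (τ : Fin m → Fin k) → dot f (fibre τ) ≡ sum (f ∘ τ)
  dot-fibre f τ =
    trans (sum-cong-≗ (λ i → *-distribˡ-sum (f i) (λ x → δ (τ x) i)))
          (trans (∑-comm (λ i x → f i * δ (τ x) i)) (sum-cong-≗ (λ x → dot-δ f (τ x))))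

  fibre-nonneg : ∀ {m k} (τ : Fin m → Fin k) i → 0ℤ ≤ fibre τ i
  fibre-nonneg τ i = sum-nonneg _ (λ x → δ-nonneg (τ x) i)

  fibre-inhabited : ∀ {m k} (τ : Fin m → Fin k) i → fibre τ i ≢ 0ℤ → ∃ λ x → τ x ≡ i
  fibre-inhabited τ i ≢0 with any? (λ x → τ x Fin.≟ i)
  ... | yes hit  = hit
  ... | no  miss = contradiction (sum-zero _ (λ x → δ-≢ (λ e → miss (x , e)))) ≢0

  fibre-image≢0 : ∀ {m k} (τ : Fin m → Fin k) x → fibre τ (τ x) ≢ 0ℤ
  fibre-image≢0 τ x ≡0
    with trans (sym (δ-refl (τ x))) (sum-nonneg-≡0 _ (λ y → δ-nonneg (τ y) (τ x)) ≡0 x)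
  ... | ()

  fibre-permute : ∀ {m m′ k} (τ : Fin m → Fin k) (τ′ : Fin m′ → Fin k) (π : Permutation m m′) →
                  (∀ x → τ′ (π ⟨$⟩ʳ x) ≡ τ x) → ∀ i → fibre τ i ≡ fibre τ′ i
  fibre-permute τ τ′ π τ′π≡τ i =
    sym (trans (sum-permute (λ y → δ (τ′ y) i) π)
               (sum-cong-≗ (λ x → cong (λ j → δ j i) (τ′π≡τ x))))

  -- Pair the first point with any `y` in the same fibre of `τ′` and remove both. The fibre over
  -- `τ zero` loses one point on either side, so the remaining sizes still agree.
  matching : ∀ {m m′ k} (τ : Fin m → Fin k) (τ′ : Fin m′ → Fin k) →
             (∀ i → fibre τ i ≡ fibre τ′ i) →
             ∃ λ (π : Permutation m m′) → ∀ x → τ′ (π ⟨$⟩ʳ x) ≡ τ x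
  matching {zero}  {zero}   τ τ′ eq = Perm.id , λ ()
  -- A map from the empty set has only empty fibres, but `τ′` has a nonempty one.
  matching {zero}  {suc m′} τ τ′ eq = contradiction (sym (eq (τ′ zero))) (fibre-image≢0 τ′ zero)
  matching {suc m} {m′}     τ τ′ eq
    with fibre-inhabited τ′ (τ zero) (λ ≡0 → fibre-image≢0 τ zero (trans (eq (τ zero)) ≡0))
  matching {suc m} {suc m′} τ τ′ eq | y , τ′y≡τ₀
    with matching (τ ∘ suc) (τ′ ∘ punchIn y) rest
    where
    rest : ∀ i → fibre (τ ∘ suc) i ≡ fibre (τ′ ∘ punchIn y) i
    rest i = +-cancelˡ (δ (τ zero) i) _ _
      (trans (eq i) (trans (sum-remove {i = y} (λ z → δ (τ′ z) i))
                           (cong (λ j → δ j i + fibre (τ′ ∘ punchIn y) i) τ′y≡τ₀)))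
  ... | π , τ′π≡τ = Perm.insert zero y π , λ where
    zero    → τ′y≡τ₀
    (suc x) → trans (cong τ′ (Perm.insert-punchIn zero y π x)) (τ′π≡τ x)

  fibre-splitAt : ∀ {a b k} (τ : Fin a → Fin k) (τ′ : Fin b → Fin k) i →
                  fibre ([ τ , τ′ ]′ ∘ splitAt a) i ≡ fibre τ i + fibre τ′ i
  fibre-splitAt {a} τ τ′ i = sum-splitAt a (λ s → δ ([ τ , τ′ ]′ s) i)

  -- An initial block of `∣ w zero ∣` points is sent to `zero`; the other values are served
  -- recursively by the points after it.
  with-fibres : ∀ {k} (w : Fin k → ℤ) → (∀ i → 0ℤ ≤ w i) →
                ∃ λ m → ∃ λ (τ : Fin m → Fin k) → ∀ i → fibre τ i ≡ w i
  with-fibres {zero}  w 0≤w = zero , (λ ()) , λ ()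
  with-fibres {suc k} w 0≤w with with-fibres (w ∘ suc) (0≤w ∘ suc)
  ... | m , τ , fibre≡w = ∣ w zero ∣ ℕ.+ m , [ const Fin.zero , Fin.suc ∘ τ ]′ ∘ splitAt ∣ w zero ∣ , λ where
    zero    → trans (fibre-splitAt {∣ w zero ∣} (const zero) (Fin.suc ∘ τ) zero)
             (trans (cong₂ _+_ (sum-one ∣ w zero ∣) (sum-zero {m} _ (λ _ → refl)))
             (trans (+-identityʳ _) (0≤i⇒+∣i∣≡i (0≤w zero))))
    (suc i) → trans (fibre-splitAt {∣ w zero ∣} (const zero) (Fin.suc ∘ τ) (suc i))
             (trans (cong₂ _+_ (sum-zero {∣ w zero ∣} _ (λ _ → refl)) (fibre≡w i)) (+-identityˡ _))

  -- Colour classes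

  -- Reads the index in binary, one digit per vertex, so that vectors indexed by vertex sets become
  -- functions on a `Fin`.
  subset : ∀ {n} → Fin (2 ^ n) → Subset n
  subset {zero}  _ = []
  subset {suc n} i = Inverse.to 2↔Bool (proj₁ (remQuot (2 ^ n) i)) ∷ subset (proj₂ (remQuot {2} (2 ^ n) i))

  index : ∀ {n} → Subset n → Fin (2 ^ n)
  index []      = zero
  index (s ∷ p) = combine (Inverse.from 2↔Bool s) (index p)

  subset-index : ∀ {n} (p : Subset n) → subset (index p) ≡ p
  subset-index []      = refl
  subset-index {suc n} (s ∷ p) = cong₂ _∷_
    (trans (cong (Inverse.to 2↔Bool ∘ proj₁) split) (Inverse.strictlyInverseˡ 2↔Bool s))
    (trans (cong (subset ∘ proj₂) split) (subset-index p))
    where split = remQuot-combine {2} (Inverse.from 2↔Bool s) (index p)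

  index-subset : ∀ {n} (i : Fin (2 ^ n)) → index (subset {n} i) ≡ i
  index-subset {zero}  zero = refl
  index-subset {suc n} i = trans
    (cong₂ combine (Inverse.strictlyInverseʳ 2↔Bool (proj₁ split)) (index-subset {n} (proj₂ split)))
    (combine-remQuot {2} (2 ^ n) i)
    where split = remQuot {2} (2 ^ n) i

  𝟙 : Bool → ℤ
  𝟙 true  = 1ℤ
  𝟙 false = 0ℤ

  has : ∀ {n} → Fin n → Fin (2 ^ n) → ℤ
  has v i = 𝟙 (lookup (subset i) v)

  ∣∣-sum : ∀ {n} (p : Subset n) → + Subset.∣ p ∣ ≡ sum (𝟙 ∘ lookup p)
  ∣∣-sum []          = refl
  ∣∣-sum (true  ∷ p) = cong (λ s → 1ℤ + s) (∣∣-sum p)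
  ∣∣-sum (false ∷ p) = trans (∣∣-sum p) (sym (+-identityˡ _))

  module _ {n : ℕ} {G : Graph n} where

    -- The colour class of `x`. A colouring stores colour sets by vertex; this is the transposed
    -- view.
    users : ∀ {b} (c : Coloring G b) → Fin (m c) → Subset n
    users c x = tabulate λ v → lookup (col c v) x

    type : ∀ {b} (c : Coloring G b) → Fin (m c) → Fin (2 ^ n)
    type c x = index (users c x)

    lookup-type : ∀ {b} (c : Coloring G b) x v → lookup (subset (type c x)) v ≡ lookup (col c v) x
    lookup-type c x v = trans (cong (λ p → lookup p v) (subset-index (users c x))) (lookup∘tabulate _ v)

    -- The integer vector that stands for the colouring from here on; it is a complete isomorphism
    -- invariant.
    count : ∀ {b} → Coloring G b → Fin (2 ^ n) → ℤ
    count c = fibre (type c)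

    -- The colours whose class contains `v` are exactly the colours at `v`.
    count-has : ∀ {b} (c : Coloring G b) v → dot (has v) (count c) ≡ + b
    count-has c v = trans (dot-fibre (has v) (type c))
      (trans (sum-cong-≗ (λ x → cong 𝟙 (lookup-type c x v)))
      (trans (sym (∣∣-sum (col c v))) (cong +_ (size c v))))

    count-total : ∀ {b} (c : Coloring G b) → sum (count c) ≡ + m c
    count-total c = trans (sum-cong-≗ (λ i → sym (*-identityˡ (count c i))))
      (trans (dot-fibre (const 1ℤ) (type c)) (sum-one (m c)))

    -- What a set must satisfy to be the class of a colour: `nonempty` mirrors `used`, and
    -- `independent` mirrors `proper`.
    record ColorClass (p : Subset n) : Set where
      field
        nonempty    : ∃ λ v → lookup p v ≡ true
        independent : ∀ u v → Adj G u v ≡ true → lookup p u ≡ true → lookup p v ≡ true → ⊥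
    open ColorClass public

    count-class : ∀ {b} (c : Coloring G b) i → count c i ≢ 0ℤ → ColorClass (subset i)
    count-class c i ≢0 with fibre-inhabited (type c) i ≢0
    ... | x , refl = record
      { nonempty    = let v , x∈ = used c x in v , trans (lookup-type c x v) ([]=⇒lookup x∈)
      ; independent = λ u v adj u∈ v∈ → proper c u v adj x (member′ u u∈) (member′ v v∈) }
      where
      member′ : ∀ v → lookup (subset (type c x)) v ≡ true → x ∈ col c v
      member′ v h = lookup⇒[]= x (col c v) (trans (sym (lookup-type c x v)) h)

    ≅⇒count : ∀ {b b′} (c : Coloring G b) (c′ : Coloring G b′) → c ≅ c′ → ∀ i → count c i ≡ count c′ i
    ≅⇒count c c′ (π , iso) = fibre-permute (type c) (type c′) π λ x →
      cong index (tabulate-cong λ v → sym (bool-≡ (iso v x)))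
      where
      bool-≡ : ∀ {v x y} → x ∈ col c v ⇔ y ∈ col c′ v → lookup (col c v) x ≡ lookup (col c′ v) y
      bool-≡ {v} {x} {y} e with lookup (col c v) x in p | lookup (col c′ v) y in q
      ... | true  | true  = refl
      ... | false | false = refl
      ... | true  | false = trans (sym ([]=⇒lookup (Equivalence.to e (lookup⇒[]= x _ p)))) q
      ... | false | true  = trans (sym p) ([]=⇒lookup (Equivalence.from e (lookup⇒[]= y _ q)))

    -- `matching` pairs the colours so that classes are preserved, and the class of a colour
    -- determines which vertices carry it.
    count⇒≅ : ∀ {b b′} (c : Coloring G b) (c′ : Coloring G b′) → (∀ i → count c i ≡ count c′ i) → c ≅ c′
    count⇒≅ c c′ eq with matching (type c) (type c′) eq
    ... | π , type-π = π , λ v x →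
      mk⇔ (λ h → lookup⇒[]= _ _ (trans (sym (same v x)) ([]=⇒lookup h)))
          (λ h → lookup⇒[]= _ _ (trans (same v x) ([]=⇒lookup h)))
      where
      same : ∀ v x → lookup (col c v) x ≡ lookup (col c′ v) (π ⟨$⟩ʳ x)
      same v x = trans (sym (lookup-type c x v))
        (trans (cong (λ i → lookup (subset i) v) (sym (type-π x))) (lookup-type c′ (π ⟨$⟩ʳ x) v))

    -- Each colour of the disjoint union keeps the class it had in its summand.
    count-⊕ : ∀ {b b′} (c : Coloring G b) (c′ : Coloring G b′) i →
              count (c ⊕ c′) i ≡ count c i + count c′ i
    count-⊕ c c′ i = trans (sum-cong-≗ (λ x → cong (λ j → δ j i) (type-⊕ x)))
                           (fibre-splitAt (type c) (type c′) i)
      where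
      pick : ∀ s → index (tabulate λ v → [ lookup (col c v) , lookup (col c′ v) ]′ s) ≡ [ type c , type c′ ]′ s
      pick (inj₁ x) = refl
      pick (inj₂ x) = refl
      type-⊕ : ∀ x → type (c ⊕ c′) x ≡ [ type c , type c′ ]′ (splitAt (m c) x)
      type-⊕ x = trans (cong index (tabulate-cong λ v → lookup-splitAt (m c) (col c v) (col c′ v) x))
                       (pick (splitAt (m c) x))

    count-· : ∀ {b} t (c : Coloring G b) i → count (t · c) i ≡ + t * count c i
    count-· zero    c i = refl
    count-· (suc t) c i = trans (count-⊕ c (t · c) i)
      (trans (cong (λ s → count c i + s) (count-· t c i)) (sym (suc-* (+ t) (count c i))))

    -- Take `w i` colours of class `i` and give each vertex the colours whose class contains it. The
    -- incidence equations fix the sizes; the class conditions give `proper` and `used`.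
    coloring : ∀ b (w : Fin (2 ^ n) → ℤ) → (∀ i → 0ℤ ≤ w i) → (∀ v → dot (has v) w ≡ + b) →
               (∀ i → w i ≢ 0ℤ → ColorClass (subset i)) →
               ∃ λ (c : Coloring G b) → ∀ i → count c i ≡ w i
    coloring b w 0≤w hasb good with with-fibres w 0≤w
    ... | k , τ , fibre≡w = κ , λ i → trans (sum-cong-≗ (λ x → cong (λ j → δ j i) (type≡τ x))) (fibre≡w i)
      where
      class : ∀ x → ColorClass (subset (τ x))
      class x = good (τ x) λ w≡0 → fibre-image≢0 τ x (trans (fibre≡w (τ x)) w≡0)
      color : Fin n → Subset k
      color v = tabulate λ x → lookup (subset (τ x)) v
      lookup-color : ∀ v x → lookup (color v) x ≡ lookup (subset (τ x)) v
      lookup-color v x = lookup∘tabulate _ x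
      ∈⇒ : ∀ {x} v → x ∈ color v → lookup (subset (τ x)) v ≡ true
      ∈⇒ {x} v x∈ = trans (sym (lookup-color v x)) ([]=⇒lookup x∈)
      κ : Coloring G b
      κ = record
        { m      = k
        ; col    = color
        ; size   = λ v → +-injective (trans (∣∣-sum (color v))
                     (trans (sum-cong-≗ (λ x → cong 𝟙 (lookup-color v x)))
                     (trans (sym (dot-fibre (has v) τ))
                     (trans (sum-cong-≗ (λ i → cong (λ z → has v i * z) (fibre≡w i))) (hasb v)))))
        ; proper = λ u v adj x x∈u x∈v → independent (class x) u v adj (∈⇒ u x∈u) (∈⇒ v x∈v)
        ; used   = λ x → let v , h = nonempty (class x) in
                     v , lookup⇒[]= x (color v) (trans (lookup-color v x) h) }
      type≡τ : ∀ x → type κ x ≡ τ x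
      type≡τ x = trans
        (cong index (trans (tabulate-cong λ v → lookup-color v x) (tabulate∘lookup (subset (τ x)))))
        (index-subset {n} (τ x))

  -- Fractional colourings

  /≤⇔*≤* : ∀ i d .{{_ : NonZero d}} τ → (i ℚ./ d) ℚ.≤ τ ⇔ i * ↧ τ ≤ ↥ τ * + d
  /≤⇔*≤* i (suc d-1) τ@(mkℚ _ _ _) = mk⇔
    (λ i/d≤τ → ℚᵘ.drop-*≤* (ℚᵘ.≤-respˡ-≃ (ℚ.toℚᵘ-fromℚᵘ (mkℚᵘ i d-1)) (ℚ.toℚᵘ-mono-≤ i/d≤τ)))
    (λ le → ℚ.toℚᵘ-cancel-≤ (ℚᵘ.≤-respˡ-≃ (ℚᵘ.≃-sym (ℚ.toℚᵘ-fromℚᵘ (mkℚᵘ i d-1))) (*≤* le)))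

  /≡/⇒*≡* : ∀ i d j e .{{_ : NonZero d}} .{{_ : NonZero e}} → i ℚ./ d ≡ j ℚ./ e → i * + e ≡ j * + d
  /≡/⇒*≡* i (suc d-1) j (suc e-1) eq = ℚᵘ.drop-*≡* (ℚ.fromℚᵘ-injective {mkℚᵘ i d-1} {mkℚᵘ j e-1} eq)

  *≡*⇒/≡/ : ∀ i d j e .{{_ : NonZero d}} .{{_ : NonZero e}} → i * + e ≡ j * + d → i ℚ./ d ≡ j ℚ./ e
  *≡*⇒/≡/ i (suc d-1) j (suc e-1) eq = ℚ.fromℚᵘ-cong {mkℚᵘ i d-1} {mkℚᵘ j e-1} (*≡* eq)

  toℚᵘ-/ : ∀ i d-1 → toℚᵘ (i ℚ./ suc d-1) ℚᵘ.≃ mkℚᵘ i d-1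
  toℚᵘ-/ i d-1 = ℚ.toℚᵘ-fromℚᵘ (mkℚᵘ i d-1)

  -- Over unnormalised rationals this is a polynomial identity. The integer `r` stands for `p - q`,
  -- which keeps truncated subtraction out of it.
  /-convex : ∀ q r p d e f i j .{{_ : NonZero p}} .{{_ : NonZero d}} .{{_ : NonZero e}} .{{_ : NonZero f}} →
             + p ≡ + q + r → + f ≡ (+ q * + e) * + d + (r * + d) * + e →
             ((+ q * + e) * i + (r * + d) * j) ℚ./ f ≡
             (+ q ℚ./ p) ℚ.* (i ℚ./ d) ℚ.+ (ℚ.1ℚ ℚ.- + q ℚ./ p) ℚ.* (j ℚ./ e)
  /-convex q r p@(suc p-1) d@(suc d-1) e@(suc e-1) f@(suc f-1) i j p≡ f≡ =
    ℚ.toℚᵘ-injective (ℚᵘ.≃-trans (toℚᵘ-/ ((+ q * + e) * i + (r * + d) * j) f-1)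
      (ℚᵘ.≃-trans (*≡* (identity (+ q) r (+ p) (+ d) (+ e) (+ f) i j p≡ f≡)) (ℚᵘ.≃-sym rhs)))
    where
    -- Stated in the shape to which the unnormalised operations unfold, hence the factors `1ℤ`.
    identity : ∀ q r p d e f i j → p ≡ q + r → f ≡ (q * e) * d + (r * d) * e →
      ((q * e) * i + (r * d) * j) * ((p * d) * ((1ℤ * p) * e)) ≡
      ((q * i) * ((1ℤ * p) * e) + ((1ℤ * p + - q * 1ℤ) * j) * (p * d)) * f
    -- The ring solver takes no hypotheses, so `p` and `f` are substituted first.
    identity q r _ d e _ i j refl refl = polynomial q r d e i j
      where
      polynomial : ∀ q r d e i j →
        ((q * e) * i + (r * d) * j) * (((q + r) * d) * ((1ℤ * (q + r)) * e)) ≡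
        ((q * i) * ((1ℤ * (q + r)) * e) + ((1ℤ * (q + r) + - q * 1ℤ) * j) * ((q + r) * d)) *
          ((q * e) * d + (r * d) * e)
      polynomial = solve-∀
    rhs : toℚᵘ ((+ q ℚ./ p) ℚ.* (i ℚ./ d) ℚ.+ (ℚ.1ℚ ℚ.- + q ℚ./ p) ℚ.* (j ℚ./ e)) ℚᵘ.≃
          mkℚᵘ (+ q) p-1 ℚᵘ.* mkℚᵘ i d-1 ℚᵘ.+ (mkℚᵘ 1ℤ 0 ℚᵘ.- mkℚᵘ (+ q) p-1) ℚᵘ.* mkℚᵘ j e-1
    rhs = begin
      toℚᵘ (λq ℚ.* (i ℚ./ d) ℚ.+ (ℚ.1ℚ ℚ.- λq) ℚ.* (j ℚ./ e))
        ≈⟨ ℚ.toℚᵘ-homo-+ (λq ℚ.* (i ℚ./ d)) ((ℚ.1ℚ ℚ.- λq) ℚ.* (j ℚ./ e)) ⟩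
      toℚᵘ (λq ℚ.* (i ℚ./ d)) ℚᵘ.+ toℚᵘ ((ℚ.1ℚ ℚ.- λq) ℚ.* (j ℚ./ e))
        ≈⟨ ℚᵘ.+-cong (ℚᵘ.≃-trans (ℚ.toℚᵘ-homo-* λq (i ℚ./ d)) (ℚᵘ.*-cong (toℚᵘ-/ (+ q) p-1) (toℚᵘ-/ i d-1)))
                     (ℚᵘ.≃-trans (ℚ.toℚᵘ-homo-* (ℚ.1ℚ ℚ.- λq) (j ℚ./ e)) (ℚᵘ.*-cong 1-λq (toℚᵘ-/ j e-1))) ⟩
      mkℚᵘ (+ q) p-1 ℚᵘ.* mkℚᵘ i d-1 ℚᵘ.+ (mkℚᵘ 1ℤ 0 ℚᵘ.- mkℚᵘ (+ q) p-1) ℚᵘ.* mkℚᵘ j e-1 ∎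
      where
      open ℚᵘ.≃-Reasoning
      λq = + q ℚ./ p
      1-λq : toℚᵘ (ℚ.1ℚ ℚ.- λq) ℚᵘ.≃ mkℚᵘ 1ℤ 0 ℚᵘ.- mkℚᵘ (+ q) p-1
      1-λq = ℚᵘ.≃-trans (ℚ.toℚᵘ-homo-+ ℚ.1ℚ (ℚ.- λq))
        (ℚᵘ.+-congʳ (mkℚᵘ 1ℤ 0) (ℚᵘ.≃-trans (ℚ.toℚᵘ-homo‿- λq) (ℚᵘ.-‿cong (toℚᵘ-/ (+ q) p-1))))

  -- Fractional colourings through their count vectors.

  module _ {n : ℕ} {G : Graph n} where

    counts : Frac G → Fin (2 ^ n) → ℤ
    counts x = count (c x)

    0<b : (x : Frac G) → 0ℤ < + b x
    0<b (frac (suc _) _) = +<+ ℕ.z<s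

    ∼⇒counts : ∀ (x y : Frac G) → x ∼ y → ∀ i → + b y * counts x i ≡ + b x * counts y i
    ∼⇒counts x y (suc s , _ , iso) i = *-cancelˡ-≡ (+ suc s) _ _
      (trans (scaled (b y) x) (trans (≅⇒count ((suc s ℕ.* b y) · c x) ((suc s ℕ.* b x) · c y) iso i) (sym (scaled (b x) y))))
      where
      scaled : ∀ t (z : Frac G) → + suc s * (+ t * counts z i) ≡ count ((suc s ℕ.* t) · c z) i
      scaled t z = trans (sym (*-assoc (+ suc s) (+ t) (counts z i)))
        (trans (cong (_* counts z i) (sym (pos-* (suc s) t))) (sym (count-· (suc s ℕ.* t) (c z) i)))

    -- Equal scaled counts already make the scaled colourings isomorphic, so the extra factor `s`
    -- can be 1.
    counts⇒∼ : ∀ (x y : Frac G) → (∀ i → + b y * counts x i ≡ + b x * counts y i) → x ∼ y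
    counts⇒∼ x y eq = 1 , _ , count⇒≅ ((1 ℕ.* b y) · c x) ((1 ℕ.* b x) · c y) λ i →
      trans (scaled (b y) x i) (trans (eq i) (sym (scaled (b x) y i)))
      where
      scaled : ∀ t (z : Frac G) i → count ((1 ℕ.* t) · c z) i ≡ + t * counts z i
      scaled t z i = trans (count-· (1 ℕ.* t) (c z) i) (cong (λ t → + t * counts z i) (ℕ.*-identityˡ t))

    ∼-sym : ∀ (x y : Frac G) → x ∼ y → y ∼ x
    ∼-sym x y x∼y = counts⇒∼ y x λ i → sym (∼⇒counts x y x∼y i)

    module _ (q p : ℕ) (q≤p : q ℕ.≤ p) .{{_ : NonZero p}} (x y : Frac G) where

      counts-comb : ∀ i → counts (comb q p q≤p x y) i ≡
                    + (q ℕ.* b y) * counts x i + + ((p ∸ q) ℕ.* b x) * counts y i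
      counts-comb i = trans (count-⊕ ((q ℕ.* b y) · c x) (((p ∸ q) ℕ.* b x) · c y) i)
                            (cong₂ _+_ (count-· (q ℕ.* b y) (c x) i) (count-· ((p ∸ q) ℕ.* b x) (c y) i))

      b-comb : + b (comb q p q≤p x y) ≡ + (q ℕ.* b y) * + b x + + ((p ∸ q) ℕ.* b x) * + b y
      b-comb = trans (pos-+ (q ℕ.* b y ℕ.* b x) _)
                     (cong₂ _+_ (pos-* (q ℕ.* b y) (b x)) (pos-* ((p ∸ q) ℕ.* b x) (b y)))

    -- The polytope F_τ in equality form: coordinate zero is the slack of g x ≤ τ, scaled by
    -- b x and the denominator of τ, so that x ∈ F_τ iff all coordinates are nonnegative.
    module Polytope (τ : ℚ) where

      slack : Frac G → ℤ
      slack x = ↥ τ * + b x + - (↧ τ * sum (counts x))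

      point : Frac G → Fin (suc (2 ^ n)) → ℤ
      point x = slack x ∷ᶠ counts x

      Fτ⇔0≤slack : ∀ x → Fτ τ x ⇔ 0ℤ ≤ slack x
      Fτ⇔0≤slack x = mk⇔
        (λ g≤τ → i≤j⇒0≤j-i (subst (_≤ ↥ τ * + b x) total (Equivalence.to m/b≤τ g≤τ)))
        (λ 0≤s → Equivalence.from m/b≤τ (subst (_≤ ↥ τ * + b x) (sym total) (0≤i-j⇒j≤i 0≤s)))
        where
        m/b≤τ : g x ℚ.≤ τ ⇔ + m (c x) * ↧ τ ≤ ↥ τ * + b x
        m/b≤τ = /≤⇔*≤* (+ m (c x)) (b x) {{nz x}} τ
        total : + m (c x) * ↧ τ ≡ ↧ τ * sum (counts x)
        total = trans (*-comm (+ m (c x)) (↧ τ)) (cong (↧ τ *_) (sym (count-total (c x))))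

      point-nonneg : ∀ x → Fτ τ x → ∀ j → 0ℤ ≤ point x j
      point-nonneg x x∈Fτ zero    = Equivalence.to (Fτ⇔0≤slack x) x∈Fτ
      point-nonneg x x∈Fτ (suc i) = fibre-nonneg (type (c x)) i

      -- The slack is a fixed linear form in `b` and the counts, and both of these combine with the
      -- same two coefficients.
      point-comb : ∀ q p (q≤p : q ℕ.≤ p) .{{_ : NonZero p}} (x y : Frac G) j →
                   point (comb q p q≤p x y) j ≡
                   + (q ℕ.* b y) * point x j + + ((p ∸ q) ℕ.* b x) * point y j
      point-comb q p q≤p x y (suc i) = counts-comb q p q≤p x y i
      point-comb q p q≤p x y zero =
        trans (cong₂ (λ d s → ↥ τ * d + - (↧ τ * s)) (b-comb q p q≤p x y)
                 (trans (sum-cong-≗ (counts-comb q p q≤p x y))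
                        (sum-linear (+ (q ℕ.* b y)) (+ ((p ∸ q) ℕ.* b x)) (counts x) (counts y))))
              (regroup (↥ τ) (↧ τ) (+ (q ℕ.* b y)) (+ ((p ∸ q) ℕ.* b x)) _ _ _ _)
        where
        regroup : ∀ t u a d x y s r → t * (a * x + d * y) + - (u * (a * s + d * r)) ≡
                                      a * (t * x + - (u * s)) + d * (t * y + - (u * r))
        regroup = solve-∀

      ∼⇒point : ∀ x y → x ∼ y → ∀ j → + b y * point x j ≡ + b x * point y j
      ∼⇒point x y x∼y (suc i) = ∼⇒counts x y x∼y i
      ∼⇒point x y x∼y zero =
        trans (expand (+ b y) (↥ τ) (+ b x) (↧ τ) (sum (counts x)))
        (trans (cong (λ s → ↥ τ * (+ b x * + b y) + - (↧ τ * s)) scaled)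
               (collect (+ b y) (↥ τ) (+ b x) (↧ τ) (sum (counts y))))
        where
        expand : ∀ y t x u s → y * (t * x + - (u * s)) ≡ t * (x * y) + - (u * (y * s))
        expand = solve-∀
        collect : ∀ y t x u s → t * (x * y) + - (u * (x * s)) ≡ x * (t * y + - (u * s))
        collect = solve-∀
        scaled : + b y * sum (counts x) ≡ + b x * sum (counts y)
        scaled = trans (*-distribˡ-sum (+ b y) (counts x))
          (trans (sum-cong-≗ (∼⇒counts x y x∼y)) (sym (*-distribˡ-sum (+ b x) (counts y))))

      Fτ-resp-∼ : ∀ x y → x ∼ y → Fτ τ x → Fτ τ y
      Fτ-resp-∼ x y x∼y x∈Fτ = Equivalence.from (Fτ⇔0≤slack y) (0<*⇒0≤ (0<b x)
        (subst (0ℤ ≤_) (∼⇒point x y x∼y zero) (0≤*0≤ (<⇒≤ (0<b y)) (point-nonneg x x∈Fτ zero))))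

      Fτ-comb : ∀ q p (q≤p : q ℕ.≤ p) .{{_ : NonZero p}} (x y : Frac G) → Fτ τ x → Fτ τ y → Fτ τ (comb q p q≤p x y)
      Fτ-comb q p q≤p x y x∈Fτ y∈Fτ = Equivalence.from (Fτ⇔0≤slack (comb q p q≤p x y))
        (subst (0ℤ ≤_) (sym (point-comb q p q≤p x y zero))
          (0≤⇒0≤+ (0≤*0≤ {+ (q ℕ.* b y)} (+≤+ ℕ.z≤n) (point-nonneg x x∈Fτ zero))
                  (0≤*0≤ {+ ((p ∸ q) ℕ.* b x)} (+≤+ ℕ.z≤n) (point-nonneg y y∈Fτ zero))))

      -- The generators lie in `Fτ`, which is closed under equivalence and combination.
      Hull⇒Fτ : ∀ {x} → Hull (Extremal τ) x → Fτ τ x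
      Hull⇒Fτ (member extremal) = proj₁ extremal
      Hull⇒Fτ (resp {x} {y} x∼y h) = Fτ-resp-∼ x y x∼y (Hull⇒Fτ h)
      Hull⇒Fτ (mix {x} {y} q p q≤p h h′) = Fτ-comb q p q≤p x y (Hull⇒Fτ h) (Hull⇒Fτ h′)

      -- The equations of the polytope and the directions that preserve them.

      row : Fin (suc n) → Fin (suc (2 ^ n)) → ℤ
      row zero    = 1ℤ ∷ᶠ const (↧ τ)
      row (suc v) = 0ℤ ∷ᶠ has v

      -- The right-hand sides for `b = 1`. Counts are not divided by `b`, so a point satisfies the
      -- equations scaled by its own `b`.
      rhs : Fin (suc n) → ℤ
      rhs zero    = ↥ τ
      rhs (suc v) = 1ℤ

      row-zero : ∀ d → dot (row zero) d ≡ d zero + ↧ τ * sum (d ∘ suc)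
      row-zero d = cong₂ _+_ (*-identityˡ (d zero)) (sym (*-distribˡ-sum (↧ τ) (d ∘ suc)))

      row-suc : ∀ v d → dot (row (suc v)) d ≡ dot (has v) (d ∘ suc)
      row-suc v d = +-identityˡ (dot (has v) (d ∘ suc))

      row-point : ∀ r x → dot (row r) (point x) ≡ rhs r * + b x
      row-point zero    x = trans (row-zero (point x)) (cancel (↥ τ * + b x) (↧ τ * sum (counts x)))
        where
        cancel : ∀ t s → (t + - s) + s ≡ t
        cancel = solve-∀
      row-point (suc v) x = trans (row-suc v (point x)) (trans (count-has (c x) v) (sym (*-identityˡ _)))

      -- A line through `x` along which every equation persists and vanishing coordinates stay zero,
      -- so that a point of `Fτ` can move some way in both senses.
      record Direction (x : Frac G) (d : Fin (suc (2 ^ n)) → ℤ) : Set where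
        field
          in-kernel : ∀ r → dot (row r) d ≡ 0ℤ
          supported : ∀ j → point x j ≡ 0ℤ → d j ≡ 0ℤ
      open Direction

      direction? : ∀ x → (∃ λ d → (∃ λ j → d j ≢ 0ℤ) × Direction x d) ⊎
                         (∀ d → Direction x d → ∀ j → d j ≡ 0ℤ)
      direction? x = convert (kernel-trivial? (⊎-searchable Fin-searchable Fin-searchable) system)
        where
        system : Fin (suc n) ⊎ Fin (suc (2 ^ n)) → Fin (suc (2 ^ n)) → ℤ
        system (inj₁ r)   = row r
        -- The support condition as linear equations: a unit row where the point vanishes and a zero
        -- row elsewhere.
        system (inj₂ j) i = 𝟙 (does (point x j ≟ 0ℤ)) * δ j i

        from-kernel : ∀ d → Kernel system d → Direction x d
        from-kernel d Ad≡0 .in-kernel r = Ad≡0 (inj₁ r)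
        from-kernel d Ad≡0 .supported j xj≡0 = trans (sym (*-identityˡ (d j)))
          (trans (cong (λ e → 𝟙 e * d j) (sym (dec-true (point x j ≟ 0ℤ) xj≡0)))
          (trans (sym (dot-scaled-δ (𝟙 (does (point x j ≟ 0ℤ))) j d)) (Ad≡0 (inj₂ j))))

        to-kernel : ∀ d → Direction x d → Kernel system d
        to-kernel d dir (inj₁ r) = in-kernel dir r
        to-kernel d dir (inj₂ j) = trans (dot-scaled-δ (𝟙 (does (point x j ≟ 0ℤ))) j d) vanishes
          where
          vanishes : 𝟙 (does (point x j ≟ 0ℤ)) * d j ≡ 0ℤ
          vanishes with point x j ≟ 0ℤ
          ... | yes xj≡0 = trans (*-identityˡ (d j)) (supported dir j xj≡0)
          ... | no  _    = refl

        convert : (∃ λ d → (∃ λ j → d j ≢ 0ℤ) × Kernel system d) ⊎ (∀ d → Kernel system d → ∀ j → d j ≡ 0ℤ) →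
                  (∃ λ d → (∃ λ j → d j ≢ 0ℤ) × Direction x d) ⊎ (∀ d → Direction x d → ∀ j → d j ≡ 0ℤ)
        convert (inj₁ (d , d≢0 , Ad≡0)) = inj₁ (d , d≢0 , from-kernel d Ad≡0)
        convert (inj₂ trivial)          = inj₂ λ d dir → trivial d (to-kernel d dir)

      negate : ∀ {x d} → Direction x d → Direction x (λ j → -1ℤ * d j)
      negate {d = d} dir .in-kernel r = trans (dot-scaleʳ (row r) -1ℤ d) (cong (-1ℤ *_) (in-kernel dir r))
      negate dir .supported j xj≡0 = cong (-1ℤ *_) (supported dir j xj≡0)

      -- Boundedness of the polytope. A set with nonzero count contains some vertex `v`, and row
      -- `suc v` is then a vanishing sum of nonnegative terms, one of which is the entry of that
      -- set. Row `zero` finally forces the slack entry to vanish.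
      nonneg-direction : ∀ {x d} → Direction x d → (∀ j → 0ℤ ≤ d j) → ∀ j → d j ≡ 0ℤ
      nonneg-direction {x} {d} dir 0≤d = λ { zero → head≡0 ; (suc i) → tail≡0 i }
        where
        tail≡0 : ∀ i → d (suc i) ≡ 0ℤ
        tail≡0 i with counts x i ≟ 0ℤ
        ... | yes ≡0 = supported dir (suc i) ≡0
        ... | no  ≢0 with nonempty (count-class (c x) i ≢0)
        ...   | v , v∈ = trans (sym (*-identityˡ (d (suc i))))
          (trans (cong (λ e → 𝟙 e * d (suc i)) (sym v∈))
            (sum-nonneg-≡0 (λ i → has v i * d (suc i)) (λ i → 0≤*0≤ (𝟙-nonneg (lookup (subset {n} i) v)) (0≤d (suc i)))
              (trans (sym (row-suc v d)) (in-kernel dir (suc v))) i))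
          where
          𝟙-nonneg : ∀ e → 0ℤ ≤ 𝟙 e
          𝟙-nonneg true  = +≤+ ℕ.z≤n
          𝟙-nonneg false = ≤-refl
        head≡0 : d zero ≡ 0ℤ
        head≡0 = trans (sym (trans (row-zero d) (trans
          (cong (λ s → d zero + ↧ τ * s) (sum-zero (d ∘ suc) tail≡0))
          (trans (cong (λ s → d zero + s) (*-zeroʳ (↧ τ))) (+-identityʳ (d zero))))))
          (in-kernel dir zero)

      negative-entry : ∀ {x d} → Direction x d → (∃ λ j → d j ≢ 0ℤ) → ∃ λ j → d j < 0ℤ
      negative-entry {x} {d} dir (j , dj≢0) with any? (λ j → d j <? 0ℤ)
      ... | yes neg  = neg
      ... | no  ¬neg = contradiction (nonneg-direction dir (λ j → ≮⇒≥ λ h → ¬neg (j , h)) j) dj≢0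

      -- The result of moving from `x` along `d` to a smaller support, with denominators cleared.
      -- Storing predecessors makes both multipliers positive by form.
      record Pushed (x : Frac G) (d : Fin (suc (2 ^ n)) → ℤ) : Set where
        field
          end        : Frac G
          a-1 e-1    : ℕ
          b-end      : + b end ≡ +[1+ a-1 ] * + b x
          point-end  : ∀ j → point end j ≡ +[1+ a-1 ] * point x j + +[1+ e-1 ] * d j
          end∈Fτ     : Fτ τ end
          fewer      : nonzeros (point end) ℕ.< nonzeros (point x)
      open Pushed

      -- With `i` from the ratio test, the multipliers are `- d i` for the point and `point x i` for
      -- the direction: the combination stays nonnegative and vanishes at `i`. It still satisfies
      -- the equations, so `coloring` realises it.
      push : ∀ {x d} → Fτ τ x → Direction x d → (∃ λ j → d j ≢ 0ℤ) → Pushed x d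
      push {x} {d} x∈Fτ dir d≢0
        with ratio-test (point x) d (point-nonneg x x∈Fτ) (negative-entry dir d≢0)
      ... | i , di<0 , bound
        with 0<⇒+suc (<0⇒0<- di<0)
           -- If `point x i` were zero, `supported` would make `d i` zero as well.
           | 0<⇒+suc (≤∧≢⇒< (point-nonneg x x∈Fτ i) λ 0≡xi → <-irrefl (supported dir i (sym 0≡xi)) di<0)
      ... | a , -di≡a | e , xi≡e = record
        { end       = y
        ; a-1       = a
        ; e-1       = e
        ; b-end     = by
        ; point-end = point-y
        ; end∈Fτ    = Equivalence.from (Fτ⇔0≤slack y) (subst (0ℤ ≤_) (sym (point-y zero)) (0≤w zero))
        ; fewer     = nonzeros-strict (point x) (point y)
                        (λ j xj≡0 → trans (point-y j) (w-supported j xj≡0)) i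
                        (λ xi≡0 → contradiction (trans (sym xi≡e) xi≡0) λ ())
                        (trans (point-y i) wi≡0)
        }
        where
        w : Fin (suc (2 ^ n)) → ℤ
        w j = +[1+ a ] * point x j + +[1+ e ] * d j

        0≤w : ∀ j → 0ℤ ≤ w j
        0≤w j = subst (0ℤ ≤_) (cong₂ (λ a e → a * point x j + e * d j) -di≡a xi≡e) (bound j)

        wi≡0 : w i ≡ 0ℤ
        wi≡0 = trans (sym (cong₂ (λ a e → a * point x i + e * d i) -di≡a xi≡e)) (cancel (d i) (point x i))
          where
          cancel : ∀ a b → - a * b + b * a ≡ 0ℤ
          cancel = solve-∀

        w-supported : ∀ j → point x j ≡ 0ℤ → w j ≡ 0ℤ
        w-supported j xj≡0 = trans (cong₂ (λ s t → +[1+ a ] * s + +[1+ e ] * t) xj≡0 (supported dir j xj≡0))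
                                   (cong₂ _+_ (*-zeroʳ +[1+ a ]) (*-zeroʳ +[1+ e ]))

        row-w : ∀ r → dot (row r) w ≡ rhs r * (+[1+ a ] * + b x)
        row-w r = trans (dot-linearʳ (row r) +[1+ a ] +[1+ e ] (point x) d)
          (trans (cong₂ (λ s t → +[1+ a ] * s + +[1+ e ] * t) (row-point r x) (in-kernel dir r))
                 (regroup +[1+ a ] (rhs r) (+ b x) +[1+ e ]))
          where
          regroup : ∀ a r b e → a * (r * b) + e * 0ℤ ≡ r * (a * b)
          regroup = solve-∀

        coloring-y : ∃ λ (c : Coloring G (suc a ℕ.* b x)) → ∀ i → count c i ≡ w (suc i)
        coloring-y = coloring (suc a ℕ.* b x) (w ∘ suc) (0≤w ∘ suc)
          (λ v → trans (sym (row-suc v w)) (trans (row-w (suc v)) (trans (*-identityˡ _) (sym (pos-* (suc a) (b x))))))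
          -- The support has not grown, so every class needed already occurs in `x`.
          (λ j wj≢0 → count-class (c x) j λ xj≡0 → wj≢0 (w-supported (suc j) xj≡0))

        y : Frac G
        y = frac (suc a ℕ.* b x) {{ℕ.m*n≢0 (suc a) (b x) {{_}} {{nz x}}}} (proj₁ coloring-y)

        by : + b y ≡ +[1+ a ] * + b x
        by = pos-* (suc a) (b x)

        point-y : ∀ j → point y j ≡ w j
        point-y (suc j) = proj₂ coloring-y j
        -- Row `zero` recovers the slack from the counts, so agreement on the counts suffices.
        point-y zero = trans (cong₂ (λ s t → s + - (↧ τ * t))
                               (trans (cong (↥ τ *_) by) (sym (row-w zero)))
                               (sum-cong-≗ (proj₂ coloring-y)))
                             (trans (cong (λ s → s + - (↧ τ * sum (w ∘ suc))) (row-zero w))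
                                    (cancel (w zero) (↧ τ * sum (w ∘ suc))))
          where
          cancel : ∀ s t → (s + t) + - t ≡ s
          cancel = solve-∀

      -- If `x` lay inside a segment from `y` to `z`, the difference of the endpoints would be a
      -- direction at `x`. Its triviality makes the endpoints equivalent.
      trivial⇒extremal : ∀ x → Fτ τ x → (∀ d → Direction x d → ∀ j → d j ≡ 0ℤ) → Extremal τ x
      trivial⇒extremal x x∈Fτ trivial = x∈Fτ , λ (y , z , q , p , p≢0 , q≤p , 0<q , q<p , y∈Fτ , z∈Fτ , y≁z , x∼) →
        y≁z (counts⇒∼ y z (no-segment y z q p {{p≢0}} q≤p 0<q q<p y∈Fτ z∈Fτ x∼))
        where
        no-segment : ∀ y z q p .{{_ : NonZero p}} (q≤p : q ℕ.≤ p) → 0 ℕ.< q → q ℕ.< p → Fτ τ y → Fτ τ z →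
                     x ∼ comb q p q≤p y z → ∀ i → + b z * counts y i ≡ + b y * counts z i
        no-segment y z q p q≤p 0<q q<p y∈Fτ z∈Fτ x∼ i = i-j≡0⇒i≡j _ _
          (trans (cong (λ t → + b z * counts y i + t) (neg-distribˡ-* (+ b y) (counts z i))) (trivial d dir (suc i)))
          where
          d : Fin (suc (2 ^ n)) → ℤ
          -- Cross-scaling gives both endpoints the same right-hand sides, which then cancel.
          d j = + b z * point y j + - (+ b y) * point z j
          α = + (q ℕ.* b z)
          β = + ((p ∸ q) ℕ.* b y)
          0<α : 0ℤ < α
          0<α = subst (0ℤ <_) (sym (pos-* q (b z))) (0<*0< (+<+ 0<q) (0<b z))
          0<β : 0ℤ < β
          0<β = subst (0ℤ <_) (sym (pos-* (p ∸ q) (b y))) (0<*0< (+<+ (ℕ.m<n⇒0<n∸m q<p)) (0<b y))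

          dir : Direction x d
          dir .in-kernel r = trans (dot-linearʳ (row r) (+ b z) (- (+ b y)) (point y) (point z))
            (trans (cong₂ (λ s t → + b z * s + - (+ b y) * t) (row-point r y) (row-point r z))
                   (cancel (+ b y) (+ b z) (rhs r)))
            where
            cancel : ∀ y z r → z * (r * y) + - y * (r * z) ≡ 0ℤ
            cancel = solve-∀
          dir .supported j xj≡0 = trans (cong₂ (λ s t → + b z * s + - (+ b y) * t)
              (*≡0⇒≡0 (<⇒≢ 0<α ∘ sym) (proj₁ both)) (*≡0⇒≡0 (<⇒≢ 0<β ∘ sym) (proj₂ both)))
              (cong₂ _+_ (*-zeroʳ (+ b z)) (*-zeroʳ (- (+ b y))))
            where
            -- Where `x` vanishes, two nonnegative terms sum to zero.
            both : α * point y j ≡ 0ℤ × β * point z j ≡ 0ℤ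
            both = +≡0⇒≡0 (0≤*0≤ (<⇒≤ 0<α) (point-nonneg y y∈Fτ j)) (0≤*0≤ (<⇒≤ 0<β) (point-nonneg z z∈Fτ j))
              (trans (sym (point-comb q p q≤p y z j))
                (*≡0⇒≡0 (<⇒≢ (0<b x) ∘ sym)
                  (trans (sym (∼⇒point x (comb q p q≤p y z) x∼ j))
                    (trans (cong (+ b (comb q p q≤p y z) *_) xj≡0) (*-zeroʳ (+ b (comb q p q≤p y z)))))))

      -- Well-founded recursion on the support size. Either there is no nonzero direction and `x` is
      -- extremal, or pushing both ways yields two points with smaller support whose combination is
      -- equivalent to `x`.
      Fτ⇒Hull : ∀ x → Acc ℕ._<_ (nonzeros (point x)) → Fτ τ x → Hull (Extremal τ) x
      Fτ⇒Hull x (acc rec) x∈Fτ with direction? x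
      ... | inj₂ trivial = member (trivial⇒extremal x x∈Fτ trivial)
      ... | inj₁ (d , d≢0@(j , dj≢0) , dir) =
        resp (∼-sym x y+z x∼y+z)
             (mix q (q ℕ.+ r) q≤q+r
               (Fτ⇒Hull y (rec (fewer Y)) (end∈Fτ Y))
               (Fτ⇒Hull z (rec (fewer Z)) (end∈Fτ Z)))
        where
        Y : Pushed x d
        Y = push x∈Fτ dir d≢0
        Z : Pushed x (λ j → -1ℤ * d j)
        Z = push x∈Fτ (negate dir) (j , λ ≡0 → dj≢0 (*≡0⇒≡0 { -1ℤ } (λ ()) ≡0))
        y = end Y
        z = end Z
        -- The weights make the two displacements e_Y · d and - e_Z · d cancel.
        q = suc (a-1 Y) ℕ.* suc (e-1 Z)
        r = suc (a-1 Z) ℕ.* suc (e-1 Y)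
        q≤q+r : q ℕ.≤ q ℕ.+ r
        q≤q+r = ℕ.m≤m+n q r
        y+z : Frac G
        y+z = comb q (q ℕ.+ r) q≤q+r y z

        -- Unprimed multipliers belong to `Y`, primed ones to `Z`; `X` and `D` are entries of the
        -- counts of `x` and of `d`. The terms in `D` cancel.
        identity : ∀ a e a′ e′ B X D →
          ((a * e′) * (a′ * B) * (a * B) + (a′ * e) * (a * B) * (a′ * B)) * X ≡
          B * ((a * e′) * (a′ * B) * (a * X + e * D) + (a′ * e) * (a * B) * (a′ * X + e′ * (-1ℤ * D)))
        identity = solve-∀

        α≡ : + (q ℕ.* b z) ≡ (+[1+ a-1 Y ] * +[1+ e-1 Z ]) * (+[1+ a-1 Z ] * + b x)
        α≡ = trans (pos-* q (b z)) (cong₂ _*_ (pos-* (suc (a-1 Y)) (suc (e-1 Z))) (b-end Z))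
        β≡ : + ((q ℕ.+ r ∸ q) ℕ.* b y) ≡ (+[1+ a-1 Z ] * +[1+ e-1 Y ]) * (+[1+ a-1 Y ] * + b x)
        β≡ = trans (cong (λ r → + (r ℕ.* b y)) (ℕ.m+n∸m≡n q r))
                   (trans (pos-* r (b y)) (cong₂ _*_ (pos-* (suc (a-1 Z)) (suc (e-1 Y))) (b-end Y)))

        x∼y+z : x ∼ y+z
        x∼y+z = counts⇒∼ x y+z λ i →
          trans (cong (_* counts x i) (trans (b-comb q (q ℕ.+ r) q≤q+r y z)
                  (cong₂ _+_ (cong₂ _*_ α≡ (b-end Y)) (cong₂ _*_ β≡ (b-end Z)))))
          (trans (identity +[1+ a-1 Y ] +[1+ e-1 Y ] +[1+ a-1 Z ] +[1+ e-1 Z ] (+ b x) (counts x i) (d (suc i)))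
          (sym (cong (+ b x *_) (trans (counts-comb q (q ℕ.+ r) q≤q+r y z i)
                  (cong₂ _+_ (cong₂ _*_ α≡ (point-end Y (suc i))) (cong₂ _*_ β≡ (point-end Z (suc i))))))))

  -- The embedding into rational coordinates.

  -- For k = 2 ^ n and e the index of ∅ this lists the 2 ^ n ∸ 1 nonempty sets.
  skip : ∀ {k} → Fin k → Fin (k ∸ 1) → Fin k
  skip {suc k} = punchIn

  skip-surjective : ∀ {k} {e i : Fin k} → e ≢ i → ∃ λ j → skip e j ≡ i
  skip-surjective {suc k} e≢i = punchOut e≢i , punchIn-punchOut e≢i

  module _ {n : ℕ} {G : Graph n} where

    coordinates : Frac G → Fin (2 ^ n ∸ 1) → ℚ
    coordinates x i = (counts x (skip (index {n} Subset.⊥) i) ℚ./ b x) {{nz x}}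

    -- Every colour is used somewhere, so leaving out the coordinate of the empty set loses no
    -- information.
    counts-∅ : ∀ (x : Frac G) → counts x (index {n} Subset.⊥) ≡ 0ℤ
    counts-∅ x with counts x (index {n} Subset.⊥) ≟ 0ℤ
    ... | yes ≡0 = ≡0
    ... | no  ≢0 with nonempty (count-class (c x) (index {n} Subset.⊥) ≢0)
    ...   | v , v∈ with trans (sym v∈) (trans (cong (λ p → lookup p v) (subset-index {n} Subset.⊥)) (lookup-replicate v false))
    ...     | ()

    ∼⇒coordinates : ∀ x y → x ∼ y → ∀ i → coordinates x i ≡ coordinates y i
    ∼⇒coordinates x y x∼y i = *≡*⇒/≡/ (counts x j) (b x) (counts y j) (b y) {{nz x}} {{nz y}}
      (trans (*-comm (counts x j) (+ b y)) (trans (∼⇒counts x y x∼y j) (*-comm (+ b x) (counts y j))))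
      where j = skip (index {n} Subset.⊥) i

    -- The omitted count is zero on both sides; the others are compared by cross-multiplication.
    coordinates⇒∼ : ∀ x y → (∀ i → coordinates x i ≡ coordinates y i) → x ∼ y
    coordinates⇒∼ x y eq = counts⇒∼ x y proportional
      where
      proportional : ∀ j → + b y * counts x j ≡ + b x * counts y j
      proportional j with index {n} Subset.⊥ Fin.≟ j
      ... | yes refl = trans (cong (+ b y *_) (counts-∅ x)) (trans (*-zeroʳ (+ b y))
                         (sym (trans (cong (+ b x *_) (counts-∅ y)) (*-zeroʳ (+ b x)))))
      ... | no ∅≢j with skip-surjective ∅≢j
      ...   | i , refl = trans (*-comm (+ b y) _)
        (trans (/≡/⇒*≡* (counts x j) (b x) (counts y j) (b y) {{nz x}} {{nz y}} (eq i)) (*-comm _ (+ b x)))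

    coordinates-comb : ∀ (q p : ℕ) (q≤p : q ℕ.≤ p) .{{p≢0 : NonZero p}} (x y : Frac G) i →
      coordinates (comb q p q≤p x y) i ≡
      (+ q ℚ./ p) ℚ.* coordinates x i ℚ.+ (ℚ.1ℚ ℚ.- + q ℚ./ p) ℚ.* coordinates y i
    coordinates-comb q p q≤p {{p≢0}} x y i =
      trans (cong (λ k → (k ℚ./ b (comb q p q≤p x y)) {{nz (comb q p q≤p x y)}}) (trans (counts-comb q p q≤p x y j)
               (cong₂ (λ s t → s * counts x j + t * counts y j) (pos-* q (b y)) (pos-* (p ∸ q) (b x)))))
            (/-convex q (+ (p ∸ q)) p (b x) (b y) (b (comb q p q≤p x y)) (counts x j) (counts y j)
               {{p≢0}} {{nz x}} {{nz y}} {{nz (comb q p q≤p x y)}}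
               (trans (cong +_ (sym (ℕ.m+[n∸m]≡n q≤p))) (pos-+ q (p ∸ q)))
               (trans (b-comb q p q≤p x y)
                  (cong₂ (λ s t → s * + b x + t * + b y) (pos-* q (b y)) (pos-* (p ∸ q) (b x)))))
      where j = skip (index {n} Subset.⊥) i

open FractionalColorings

open import Data.Nat using (ℕ; _≤_; _^_; _∸_; NonZero)
open import Data.Nat.Induction using (<-wellFounded)
open import Data.Fin using (Fin)
open import Data.Product using (Σ; _×_; _,_)
open import Data.Integer using (+_)
open import Data.Rational using (ℚ; _/_; _*_; _+_; _-_; 1ℚ)
open import Function.Bundles using (_⇔_; mk⇔)
open import Relation.Binary.PropositionalEquality using (_≡_)

theorem2 : ∀ (n : ℕ) (G : Graph n) →
    (Σ (Frac G → Fin (2 ^ n ∸ 1) → ℚ) λ φ →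
        (∀ x y → x ∼ y → ∀ i → φ x i ≡ φ y i)
      × (∀ x y → (∀ i → φ x i ≡ φ y i) → x ∼ y)
      × (∀ (q p : ℕ) (q≤p : q ≤ p) .{{_ : NonZero p}} (x y : Frac G) (i : Fin (2 ^ n ∸ 1)) →
           φ (comb q p q≤p x y) i ≡ ((+ q) / p) * φ x i + (1ℚ - (+ q) / p) * φ y i))
    × (∀ (τ : ℚ) → Σ (Frac G → Set) λ S →
           (∀ x → S x → Extremal τ x)
         × (∀ x → Fτ τ x ⇔ Hull S x))
theorem2 n G =
    (coordinates , ∼⇒coordinates , coordinates⇒∼ , coordinates-comb)
  -- All extremal colourings together serve as the generating set.
  , λ τ → Extremal τ , (λ _ extremal → extremal)
        , λ x → mk⇔ (Polytope.Fτ⇒Hull τ x (<-wellFounded _)) (Polytope.Hull⇒Fτ τ)
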